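{- For every integer $k\ge 0$, every integer $m\ge 2$ and every integer $i$ with $1\le i\le m-1$, $$\tilde d_{i,k}^2(m)\bigl(\tilde d_{i,k}^2(m)-\tilde d_{i-1,k}(m)\tilde d_{i+1,k}(m)\bigr)>\tilde d_{i-1,k}^2(m)\bigl(\tilde d_{i+1,k}^2(m)-\tilde d_{i,k}(m)\tilde d_{i+2,k}(m)\bigr).$$
   Context: For integers $m\ge 0$ and $0\le i\le m$, the Boros–Moll numbers are $$d_i(m)=2^{ -2m}\sum_{j=i}^{m}2^j\binom{2m-2j}{m-j}\binom{m+j}{j}\binom{j}{i},$$ with the convention $d_i(m)=0$ for $i>m$. For an integer $k\ge 0$ the normalized Boros–Moll numbers are $\tilde d_{i,k}(m)=d_i(m)/(i+k)!$ for $i\ge 0$ (so $\tilde d_{i,k}(m)=0$ for $i>m$). -}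

module Defs where

open import Data.Nat.Base as ℕ using (ℕ; suc; _∸_; _^_; _!)
open import Data.Nat.Combinatorics using (_C_)
open import Data.Nat.Properties using (m^n≢0; _!≢0)
open import Data.Integer.Base using (+_)
open import Data.List.Base using (map; upTo)
open import Data.Nat.ListAction using (sum)
open import Data.Rational.Base using (ℚ; _/_; _*_)

infix 9 _²

_² : ℚ → ℚ
x ² = x * x

-- Σ[ j = a to b ] f j, empty when a > b.
sumFromTo : ℕ → ℕ → (ℕ → ℕ) → ℕ
sumFromTo a b f = sum (map (λ t → f (a ℕ.+ t)) (upTo (suc b ∸ a)))

-- d i m is the Boros–Moll number d_i(m). The convention d_i(m) = 0 for i > m
-- holds because the sum is then empty. Every index satisfies j ≤ m, so the
-- truncated subtractions are exact.
d : ℕ → ℕ → ℚ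
d i m = + sumFromTo i m term / 2 ^ (2 ℕ.* m)
  where
  instance _ = m^n≢0 2 (2 ℕ.* m)
  term : ℕ → ℕ
  term j = 2 ^ j ℕ.* ((2 ℕ.* m ∸ 2 ℕ.* j) C (m ∸ j)) ℕ.* ((m ℕ.+ j) C j) ℕ.* (j C i)

-- d̃ i k m is the normalized number d_i(m) / (i + k)!.
d̃ : ℕ → ℕ → ℕ → ℚ
d̃ i k m = d i m * (+ 1 / (i ℕ.+ k) !)
  where instance _ = (i ℕ.+ k) !≢0

{-# OPTIONS --safe #-}
module Submission where

-- Fix m, let Sᵢ = 4ᵐ dᵢ(m) and (a , b , c , e) = (Sᵢ₋₁ , Sᵢ , Sᵢ₊₁ , Sᵢ₊₂).
-- The polynomial Σ Sᵢ xⁱ satisfies (1 − x²) f″ − (2x + 2m + 1) f′ + m(m + 1) f = 0,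
-- which is the three-term recurrence
--   i(i + 1) c + (m + 1 − i)(m + i) a = i(2m + 1) b.
-- Read downwards from Sₘ₊₁ = 0 it gives, with j = i + 1 and h = m − i,
--   j c ≤ h b   and   2h b ≤ (2j + 1) c.
-- Eliminating a and e by the recurrence and using these bounds for c / b yields
-- (i + 1) a c ≤ i b² and a cubic inequality which together imply
--   b⁴ + a² b e ≥ a b² c + a² c²,
-- the limit k → ∞ of the claim. Finite k only helps: expanding the inequality for
-- dᵢ/(i + k)! in powers of N = i + k, every coefficient is nonnegative and the
-- constant one is positive.

open import Defs
open import Data.Nat.Base as ℕ using (ℕ; zero; suc; _∸_; _^_; _!; NonZero; z≤n; s≤s)
import Data.Nat.Properties as ℕ
open import Data.Nat.Combinatorics using (_C_; k>n⇒nCk≡0; nC1≡n; nCk+nC[k+1]≡[n+1]C[k+1])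
open import Data.Nat.ListAction using (sum)
open import Data.Nat.ListAction.Properties using (sum-++)
open import Data.Nat.Tactic.RingSolver using (solve-∀)
open import Data.List.Base using (map; upTo; _∷_; []; _++_)
open import Data.List.Properties using (map-++; upTo-∷ʳ)
open import Data.Product.Base using (_×_; _,_; proj₁; proj₂)
open import Relation.Binary.PropositionalEquality

-- Binomial identities and the weights of the Boros-Moll sum.

module Recurrence where

  open import Data.Nat.Base using (_+_; _*_; _≤_; _<_)
  open import Data.Nat.Properties
  open ≡-Reasoning

  absorption : ∀ n k → (1 + k) * ((1 + n) C (1 + k)) ≡ (1 + n) * (n C k)
  absorption zero    zero    = refl
  absorption zero    (suc k) = trans (cong (suc (suc k) *_) (k>n⇒nCk≡0 {1} {suc (suc k)} (s≤s (s≤s z≤n))))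
                              (trans (*-zeroʳ (suc (suc k))) (cong (1 *_) (sym (k>n⇒nCk≡0 {0} {suc k} (s≤s z≤n)))))
  absorption (suc n) zero    = begin
    1 * ((2 + n) C 1)              ≡⟨ *-identityˡ _ ⟩
    (2 + n) C 1                    ≡⟨ nC1≡n (2 + n) ⟩
    2 + n                          ≡⟨ *-identityʳ (2 + n) ⟨
    (2 + n) * 1 ∎
  absorption (suc n) (suc k) = begin
    (2 + k) * ((2 + n) C (2 + k))
      ≡⟨ cong ((2 + k) *_) (nCk+nC[k+1]≡[n+1]C[k+1] (1 + n) (1 + k)) ⟨
    (2 + k) * (((1 + n) C (1 + k)) + ((1 + n) C (2 + k)))
      ≡⟨ split k ((1 + n) C (1 + k)) ((1 + n) C (2 + k)) ⟩
    ((1 + n) C (1 + k)) + ((1 + k) * ((1 + n) C (1 + k)) + (2 + k) * ((1 + n) C (2 + k)))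
      ≡⟨ cong (((1 + n) C (1 + k)) +_) (cong₂ _+_ (absorption n k) (absorption n (1 + k))) ⟩
    ((1 + n) C (1 + k)) + ((1 + n) * (n C k) + (1 + n) * (n C (1 + k)))
      ≡⟨ cong (((1 + n) C (1 + k)) +_) (*-distribˡ-+ (1 + n) (n C k) (n C (1 + k))) ⟨
    ((1 + n) C (1 + k)) + (1 + n) * ((n C k) + (n C (1 + k)))
      ≡⟨ cong (λ z → ((1 + n) C (1 + k)) + (1 + n) * z) (nCk+nC[k+1]≡[n+1]C[k+1] n k) ⟩
    (2 + n) * ((1 + n) C (1 + k)) ∎
    where
    split : ∀ k x y → (2 + k) * (x + y) ≡ x + ((1 + k) * x + (2 + k) * y)
    split = solve-∀

  -- Pascal's rule followed by `absorption`. It replaces the ratio (n - k) / (k + 1) of neighbouring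
  -- binomials, where n - k would be truncated.
  nextBinomial : ∀ n k → k * (n C k) + (1 + k) * (n C (1 + k)) ≡ n * (n C k)
  nextBinomial n k = +-cancelˡ-≡ (n C k) _ _ (begin
    (n C k) + (k * (n C k) + (1 + k) * (n C (1 + k)))  ≡⟨ regroup k (n C k) (n C (1 + k)) ⟩
    (1 + k) * ((n C k) + (n C (1 + k)))                ≡⟨ cong ((1 + k) *_) (nCk+nC[k+1]≡[n+1]C[k+1] n k) ⟩
    (1 + k) * ((1 + n) C (1 + k))                      ≡⟨ absorption n k ⟩
    (1 + n) * (n C k) ∎)
    where
    regroup : ∀ k x y → x + (k * x + (1 + k) * y) ≡ (1 + k) * (x + y)
    regroup = solve-∀

  centralBinomial-suc : ∀ t → (1 + t) * ((2 * (1 + t)) C (1 + t)) ≡ 2 * ((1 + 2 * t) * ((2 * t) C t))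
  centralBinomial-suc t = begin
    (1 + t) * ((2 * (1 + t)) C (1 + t))            ≡⟨ cong (λ z → (1 + t) * (z C (1 + t))) (even t) ⟩
    (1 + t) * ((2 + 2 * t) C (1 + t))              ≡⟨ absorption (1 + 2 * t) t ⟩
    (2 + 2 * t) * ((1 + 2 * t) C t)                ≡⟨ cong ((2 + 2 * t) *_) middle ⟨
    (2 + 2 * t) * ((1 + 2 * t) C (1 + t))          ≡⟨ regroup t ((1 + 2 * t) C (1 + t)) ⟩
    2 * ((1 + t) * ((1 + 2 * t) C (1 + t)))        ≡⟨ cong (2 *_) (absorption (2 * t) t) ⟩
    2 * ((1 + 2 * t) * ((2 * t) C t)) ∎
    where
    even : ∀ t → 2 * (1 + t) ≡ 2 + 2 * t
    even = solve-∀
    regroup : ∀ t x → (2 + 2 * t) * x ≡ 2 * ((1 + t) * x)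
    regroup = solve-∀
    odd : ∀ t x → (1 + 2 * t) * x ≡ t * x + (1 + t) * x
    odd = solve-∀
    -- Symmetry of the two middle binomials, read off from `nextBinomial` because n - k = k + 1 for
    -- n = 2t + 1 and k = t.
    middle : (1 + 2 * t) C (1 + t) ≡ (1 + 2 * t) C t
    middle = *-cancelˡ-≡ _ _ (1 + t) (+-cancelˡ-≡ (t * ((1 + 2 * t) C t)) _ _
      (trans (nextBinomial (1 + 2 * t) t) (odd t ((1 + 2 * t) C t))))

  -- The coefficient of (1 + x)ʲ when Σ Sᵢ xⁱ is expanded in powers of 1 + x.
  weight : ℕ → ℕ → ℕ
  weight m j = 2 ^ j * ((2 * m ∸ 2 * j) C (m ∸ j)) * ((m + j) C j)

  weight-+ : ∀ j t → weight (j + t) j ≡ 2 ^ j * ((2 * t) C t) * ((j + t + j) C j)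
  weight-+ j t = cong₂ (λ x y → 2 ^ j * (x C y) * ((j + t + j) C j))
    (trans (sym (*-distribˡ-∸ 2 (j + t) j)) (cong (2 *_) (m+n∸m≡n j t)))
    (m+n∸m≡n j t)

  -- Here t = m - j - 1. With L the operator of the differential equation, the two factors are, up
  -- to sign, the coefficients of (1 + x)ʲ in L((1 + x)ʲ) and L((1 + x)ʲ⁺¹). The equality makes
  -- these contributions cancel.
  weight-suc : ∀ m j t → j + suc t ≡ m →
    (1 + t) * (2 + t + 2 * j) * weight m j ≡ (1 + 2 * t) * (1 + j) * weight m (1 + j)
  weight-suc _ j t refl = begin
    (1 + t) * (2 + t + 2 * j) * weight (j + suc t) j
      ≡⟨ cong ((1 + t) * (2 + t + 2 * j) *_) (weight-+ j (suc t)) ⟩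
    (1 + t) * (2 + t + 2 * j) * (2 ^ j * K * L)
      ≡⟨ regroup₁ t j (2 ^ j) K L ⟩
    2 ^ j * ((1 + t) * K) * ((1 + (j + (1 + t) + j)) * L)
      ≡⟨ cong₂ (λ x y → 2 ^ j * x * y) (centralBinomial-suc t) (sym (absorption (j + suc t + j) j)) ⟩
    2 ^ j * (2 * ((1 + 2 * t) * K′)) * ((1 + j) * ((1 + (j + suc t + j)) C (1 + j)))
      ≡⟨ cong (λ z → 2 ^ j * (2 * ((1 + 2 * t) * K′)) * ((1 + j) * (z C (1 + j)))) (shift j t) ⟩
    2 ^ j * (2 * ((1 + 2 * t) * K′)) * ((1 + j) * L′)
      ≡⟨ regroup₂ t j (2 ^ j) K′ L′ ⟩
    (1 + 2 * t) * (1 + j) * (2 ^ (1 + j) * K′ * L′)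
      ≡⟨ cong ((1 + 2 * t) * (1 + j) *_) (weight-+ (1 + j) t) ⟨
    (1 + 2 * t) * (1 + j) * weight (suc j + t) (1 + j)
      ≡⟨ cong (λ z → (1 + 2 * t) * (1 + j) * weight z (1 + j)) (+-suc j t) ⟨
    (1 + 2 * t) * (1 + j) * weight (j + suc t) (1 + j) ∎
    where
    K = (2 * suc t) C suc t
    K′ = (2 * t) C t
    L = (j + suc t + j) C j
    L′ = (suc j + t + suc j) C suc j
    regroup₁ : ∀ t j p K L → (1 + t) * (2 + t + 2 * j) * (p * K * L) ≡
               p * ((1 + t) * K) * ((1 + (j + (1 + t) + j)) * L)
    regroup₁ = solve-∀
    regroup₂ : ∀ t j p K L → p * (2 * ((1 + 2 * t) * K)) * ((1 + j) * L) ≡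
               (1 + 2 * t) * (1 + j) * (2 * p * K * L)
    regroup₂ = solve-∀
    shift : ∀ j t → 1 + (j + (1 + t) + j) ≡ 1 + j + t + (1 + j)
    shift = solve-∀

  -- Finite sums.

  -- Recursion splits off the last summand, as the induction in `telescope` requires; `upTo` unfolds
  -- from the first.
  sumBelow : ℕ → (ℕ → ℕ) → ℕ
  sumBelow zero    f = 0
  sumBelow (suc n) f = sumBelow n f + f n

  sum-upTo : ∀ n f → sum (map f (upTo n)) ≡ sumBelow n f
  sum-upTo zero    f = refl
  sum-upTo (suc n) f = begin
    sum (map f (upTo (suc n)))        ≡⟨ cong (λ l → sum (map f l)) (upTo-∷ʳ n) ⟨
    sum (map f (upTo n ++ n ∷ []))    ≡⟨ cong sum (map-++ f (upTo n) (n ∷ [])) ⟩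
    sum (map f (upTo n) ++ f n ∷ [])  ≡⟨ sum-++ (map f (upTo n)) (f n ∷ []) ⟩
    sum (map f (upTo n)) + (f n + 0)  ≡⟨ cong₂ _+_ (sum-upTo n f) (+-identityʳ (f n)) ⟩
    sumBelow n f + f n ∎

  sumBelow-shift : ∀ a n f → (∀ j → j < a → f j ≡ 0) →
    sumBelow (n + a) f ≡ sumBelow n (λ t → f (a + t))
  sumBelow-shift zero    zero f f≡0 = refl
  sumBelow-shift (suc a) zero f f≡0 = cong₂ _+_
    (sumBelow-shift a zero f (λ j j<a → f≡0 j (m<n⇒m<1+n j<a))) (f≡0 a ≤-refl)
  sumBelow-shift a (suc n) f f≡0 = cong₂ _+_ (sumBelow-shift a n f f≡0) (cong f (+-comm n a))

  sumFromTo≡sumBelow : ∀ a b f → a ≤ suc b → (∀ j → j < a → f j ≡ 0) →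
    sumFromTo a b f ≡ sumBelow (suc b) f
  sumFromTo≡sumBelow a b f a≤1+b f≡0 = begin
    sum (map (λ t → f (a + t)) (upTo (suc b ∸ a)))  ≡⟨ sum-upTo (suc b ∸ a) _ ⟩
    sumBelow (suc b ∸ a) (λ t → f (a + t))          ≡⟨ sumBelow-shift a (suc b ∸ a) f f≡0 ⟨
    sumBelow (suc b ∸ a + a) f                      ≡⟨ cong (λ n → sumBelow n f) (m∸n+n≡m a≤1+b) ⟩
    sumBelow (suc b) f ∎

  -- The three-term recurrence by telescoping.

  partialNumerator : ℕ → ℕ → ℕ → ℕ
  partialNumerator m n i = sumBelow n (λ j → weight m j * (j C i))

  -- This is Sᵢ. Starting at j = 0 instead of j = i adds only zeros and gives all i the same range,
  -- so that sums for neighbouring i combine term by term.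
  numerator : ℕ → ℕ → ℕ
  numerator m i = partialNumerator m (suc m) i

  numerator-sumFromTo : ∀ m i → i ≤ suc m → sumFromTo i m (λ j → weight m j * (j C i)) ≡ numerator m i
  numerator-sumFromTo m i i≤1+m = sumFromTo≡sumBelow i m _ i≤1+m
    (λ j j<i → trans (cong (weight m j *_) (k>n⇒nCk≡0 j<i)) (*-zeroʳ (weight m j)))

  -- The coefficient of xˡ⁺¹ in x L((1 + x)ʲ) for the operator L of the differential equation,
  -- with t = m − j: L((1 + x)ʲ) = t(m + j + 1)(1 + x)ʲ − j(2t + 1)(1 + x)ʲ⁻¹.
  -- Negative terms are moved across, so that no subtraction occurs.
  operatorOnBinomial : ∀ m j t l → j + t ≡ m →
    (1 + l) * (2 + l) * (j C (2 + l)) + m * (1 + m) * (j C l) + (1 + 2 * t) * ((1 + l) * (j C (1 + l))) ≡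
    l * (1 + l) * (j C l) + (1 + l) * (1 + 2 * m) * (j C (1 + l)) + t * (1 + t + 2 * j) * (j C l)
  operatorOnBinomial _ j t l refl =
    +-cancelˡ-≡ ((1 + l) * ((1 + l) * (j C (1 + l))) + (1 + l) * (l * (j C l))) _ _ (begin
    (1 + l) * ((1 + l) * C₁) + (1 + l) * (l * C₀) +
      ((1 + l) * (2 + l) * C₂ + (j + t) * (1 + (j + t)) * C₀ + (1 + 2 * t) * ((1 + l) * C₁))
      ≡⟨ regroup₁ j t l C₀ C₁ C₂ ⟩
    (1 + l) * ((1 + l) * C₁ + (2 + l) * C₂) + (1 + l) * (l * C₀) + (1 + 2 * t) * ((1 + l) * C₁) +
      (t * (1 + t + 2 * j) * C₀ + (1 + j) * (j * C₀))
      ≡⟨ cong₂ (λ x y → (1 + l) * x + (1 + l) * (l * C₀) + (1 + 2 * t) * ((1 + l) * C₁) +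
           (t * (1 + t + 2 * j) * C₀ + (1 + j) * y))
           (nextBinomial j (1 + l)) (sym (nextBinomial j l)) ⟩
    (1 + l) * (j * C₁) + (1 + l) * (l * C₀) + (1 + 2 * t) * ((1 + l) * C₁) +
      (t * (1 + t + 2 * j) * C₀ + (1 + j) * (l * C₀ + (1 + l) * C₁))
      ≡⟨ regroup₂ j t l C₀ C₁ ⟩
    l * (j * C₀) + rest j t l C₀ C₁
      ≡⟨ cong (λ x → l * x + rest j t l C₀ C₁) (nextBinomial j l) ⟨
    l * (l * C₀ + (1 + l) * C₁) + rest j t l C₀ C₁
      ≡⟨ regroup₃ j t l C₀ C₁ ⟩
    (1 + l) * ((1 + l) * C₁) + (1 + l) * (l * C₀) +
      (l * (1 + l) * C₀ + (1 + l) * (1 + 2 * (j + t)) * C₁ + t * (1 + t + 2 * j) * C₀) ∎)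
    where
    C₀ = j C l
    C₁ = j C (1 + l)
    C₂ = j C (2 + l)
    rest : ℕ → ℕ → ℕ → ℕ → ℕ → ℕ
    rest j t l x y = (1 + l) * (j * y) + (1 + l) * (l * x) + (1 + 2 * t) * ((1 + l) * y) +
      (t * (1 + t + 2 * j) * x + l * x + (1 + j) * ((1 + l) * y))
    regroup₁ : ∀ j t l x y z → (1 + l) * ((1 + l) * y) + (1 + l) * (l * x) +
      ((1 + l) * (2 + l) * z + (j + t) * (1 + (j + t)) * x + (1 + 2 * t) * ((1 + l) * y)) ≡
      (1 + l) * ((1 + l) * y + (2 + l) * z) + (1 + l) * (l * x) + (1 + 2 * t) * ((1 + l) * y) +
      (t * (1 + t + 2 * j) * x + (1 + j) * (j * x))
    regroup₁ = solve-∀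
    regroup₂ : ∀ j t l x y → (1 + l) * (j * y) + (1 + l) * (l * x) + (1 + 2 * t) * ((1 + l) * y) +
      (t * (1 + t + 2 * j) * x + (1 + j) * (l * x + (1 + l) * y)) ≡
      l * (j * x) + ((1 + l) * (j * y) + (1 + l) * (l * x) + (1 + 2 * t) * ((1 + l) * y) +
      (t * (1 + t + 2 * j) * x + l * x + (1 + j) * ((1 + l) * y)))
    regroup₂ = solve-∀
    regroup₃ : ∀ j t l x y → l * (l * x + (1 + l) * y) +
      ((1 + l) * (j * y) + (1 + l) * (l * x) + (1 + 2 * t) * ((1 + l) * y) +
      (t * (1 + t + 2 * j) * x + l * x + (1 + j) * ((1 + l) * y))) ≡
      (1 + l) * ((1 + l) * y) + (1 + l) * (l * x) +
      (l * (1 + l) * x + (1 + l) * (1 + 2 * (j + t)) * y + t * (1 + t + 2 * j) * x)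
    regroup₃ = solve-∀

  -- Including the summand j trades one remainder for another: by `operatorOnBinomial`, the (1 +
  -- x)ʲ⁻¹ part of L((1 + x)ʲ) cancels the old remainder and the (1 + x)ʲ part is the new one.
  telescope-step : ∀ m j t l → j + t ≡ m →
    (1 + l) * (2 + l) * partialNumerator m j (2 + l) + m * (1 + m) * partialNumerator m j l ≡
      l * (1 + l) * partialNumerator m j l + (1 + l) * (1 + 2 * m) * partialNumerator m j (1 + l)
      + weight m j * ((1 + 2 * t) * ((1 + l) * (j C (1 + l)))) →
    (1 + l) * (2 + l) * partialNumerator m (1 + j) (2 + l) + m * (1 + m) * partialNumerator m (1 + j) l ≡
      l * (1 + l) * partialNumerator m (1 + j) l + (1 + l) * (1 + 2 * m) * partialNumerator m (1 + j) (1 + l)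
      + weight m j * (t * (1 + t + 2 * j) * (j C l))
  telescope-step m j t l j+t≡m hyp = begin
    (1 + l) * (2 + l) * (p₂ + w * C₂) + m * (1 + m) * (p₀ + w * C₀)
      ≡⟨ regroup₁ m l w p₀ p₂ C₀ C₂ ⟩
    ((1 + l) * (2 + l) * p₂ + m * (1 + m) * p₀) + w * ((1 + l) * (2 + l) * C₂ + m * (1 + m) * C₀)
      ≡⟨ cong (_+ w * ((1 + l) * (2 + l) * C₂ + m * (1 + m) * C₀)) hyp ⟩
    (q + w * ((1 + 2 * t) * ((1 + l) * C₁))) + w * ((1 + l) * (2 + l) * C₂ + m * (1 + m) * C₀)
      ≡⟨ regroup₂ q w ((1 + 2 * t) * ((1 + l) * C₁)) ((1 + l) * (2 + l) * C₂ + m * (1 + m) * C₀) ⟩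
    q + w * ((1 + l) * (2 + l) * C₂ + m * (1 + m) * C₀ + (1 + 2 * t) * ((1 + l) * C₁))
      ≡⟨ cong (λ x → q + w * x) (operatorOnBinomial m j t l j+t≡m) ⟩
    q + w * (l * (1 + l) * C₀ + (1 + l) * (1 + 2 * m) * C₁ + t * (1 + t + 2 * j) * C₀)
      ≡⟨ regroup₃ m l w p₀ p₁ C₀ C₁ (t * (1 + t + 2 * j) * C₀) ⟩
    l * (1 + l) * (p₀ + w * C₀) + (1 + l) * (1 + 2 * m) * (p₁ + w * C₁)
      + w * (t * (1 + t + 2 * j) * C₀) ∎
    where
    C₀ = j C l
    C₁ = j C (1 + l)
    C₂ = j C (2 + l)
    w = weight m j
    p₀ = partialNumerator m j l
    p₁ = partialNumerator m j (1 + l)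
    p₂ = partialNumerator m j (2 + l)
    q = l * (1 + l) * p₀ + (1 + l) * (1 + 2 * m) * p₁
    regroup₁ : ∀ m l w p₀ p₂ x z → (1 + l) * (2 + l) * (p₂ + w * z) + m * (1 + m) * (p₀ + w * x) ≡
      ((1 + l) * (2 + l) * p₂ + m * (1 + m) * p₀) + w * ((1 + l) * (2 + l) * z + m * (1 + m) * x)
    regroup₁ = solve-∀
    regroup₂ : ∀ q w x y → (q + w * x) + w * y ≡ q + w * (y + x)
    regroup₂ = solve-∀
    regroup₃ : ∀ m l w p₀ p₁ x y z →
      l * (1 + l) * p₀ + (1 + l) * (1 + 2 * m) * p₁ + w * (l * (1 + l) * x + (1 + l) * (1 + 2 * m) * y + z) ≡
      l * (1 + l) * (p₀ + w * x) + (1 + l) * (1 + 2 * m) * (p₁ + w * y) + w * z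
    regroup₃ = solve-∀

  -- Applied to the first j summands, L leaves a single term. It is 0 for j = 0, and `weight-suc`
  -- brings the output of `telescope-step` into the form needed for the next j.
  telescope : ∀ m j t l → j + t ≡ m →
    (1 + l) * (2 + l) * partialNumerator m j (2 + l) + m * (1 + m) * partialNumerator m j l ≡
      l * (1 + l) * partialNumerator m j l + (1 + l) * (1 + 2 * m) * partialNumerator m j (1 + l)
      + weight m j * ((1 + 2 * t) * ((1 + l) * (j C (1 + l))))
  telescope m zero t l eq = base m t l (weight m 0) (0 C (1 + l)) (k>n⇒nCk≡0 {0} {1 + l} (s≤s z≤n))
    where
    zeros : ∀ m t l w → (1 + l) * (2 + l) * 0 + m * (1 + m) * 0 ≡
      l * (1 + l) * 0 + (1 + l) * (1 + 2 * m) * 0 + w * ((1 + 2 * t) * ((1 + l) * 0))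
    zeros = solve-∀
    base : ∀ m t l w c → c ≡ 0 → (1 + l) * (2 + l) * 0 + m * (1 + m) * 0 ≡
      l * (1 + l) * 0 + (1 + l) * (1 + 2 * m) * 0 + w * ((1 + 2 * t) * ((1 + l) * c))
    base m t l w _ refl = zeros m t l w
  telescope m (suc j) t l eq = begin
    (1 + l) * (2 + l) * partialNumerator m (suc j) (2 + l) + m * (1 + m) * partialNumerator m (suc j) l
      ≡⟨ telescope-step m j (suc t) l eq′ (telescope m j (suc t) l eq′) ⟩
    q + weight m j * ((1 + t) * (2 + t + 2 * j) * (j C l))
      ≡⟨ cong (q +_) carry ⟩
    q + weight m (suc j) * ((1 + 2 * t) * ((1 + l) * (suc j C suc l))) ∎
    where
    eq′ : j + suc t ≡ m
    eq′ = trans (+-suc j t) eq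
    q = l * (1 + l) * partialNumerator m (suc j) l + (1 + l) * (1 + 2 * m) * partialNumerator m (suc j) (1 + l)
    regroup₁ : ∀ x y z → x * (y * z) ≡ y * x * z
    regroup₁ = solve-∀
    regroup₂ : ∀ x y z w → x * y * w * z ≡ w * (x * (y * z))
    regroup₂ = solve-∀
    carry : weight m j * ((1 + t) * (2 + t + 2 * j) * (j C l)) ≡
            weight m (suc j) * ((1 + 2 * t) * ((1 + l) * (suc j C suc l)))
    carry = begin
      weight m j * ((1 + t) * (2 + t + 2 * j) * (j C l))
        ≡⟨ regroup₁ (weight m j) ((1 + t) * (2 + t + 2 * j)) (j C l) ⟩
      (1 + t) * (2 + t + 2 * j) * weight m j * (j C l)
        ≡⟨ cong (_* (j C l)) (weight-suc m j t eq′) ⟩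
      (1 + 2 * t) * (1 + j) * weight m (suc j) * (j C l)
        ≡⟨ regroup₂ (1 + 2 * t) (1 + j) (j C l) (weight m (suc j)) ⟩
      weight m (suc j) * ((1 + 2 * t) * ((1 + j) * (j C l)))
        ≡⟨ cong (λ x → weight m (suc j) * ((1 + 2 * t) * x)) (absorption j l) ⟨
      weight m (suc j) * ((1 + 2 * t) * ((1 + l) * (suc j C suc l))) ∎

  numerator-recurrence : ∀ m l →
    (1 + l) * (2 + l) * numerator m (2 + l) + m * (1 + m) * numerator m l ≡
    l * (1 + l) * numerator m l + (1 + l) * (1 + 2 * m) * numerator m (1 + l)
  numerator-recurrence m l = begin
    (1 + l) * (2 + l) * numerator m (2 + l) + m * (1 + m) * numerator m l
      -- The last summand is j = m, where t = m - j = 0 is a factor of the remainder.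
      ≡⟨ telescope-step m m 0 l (+-identityʳ m) (telescope m m 0 l (+-identityʳ m)) ⟩
    q + weight m m * 0   ≡⟨ cong (q +_) (*-zeroʳ (weight m m)) ⟩
    q + 0                ≡⟨ +-identityʳ q ⟩
    q ∎
    where
    q = l * (1 + l) * numerator m l + (1 + l) * (1 + 2 * m) * numerator m (1 + l)

open Recurrence

-- Bounds for the ratio of consecutive numerators.

module Inequalities where

  open import Data.Nat.Base using (_+_; _*_; _≤_; _<_; >-nonZero; >-nonZero⁻¹)
  open import Data.Nat.Properties

  -- Reduces a polynomial inequality with an explicit difference `s` to an identity for the ring
  -- solver.
  ≤-fromSlack : ∀ {x y} s → x + s ≡ y → x ≤ y
  ≤-fromSlack {x} s refl = m≤m+n x s

  m+n≢0 : ∀ m n .{{_ : NonZero n}} → NonZero (m + n)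
  m+n≢0 m (suc n) = subst NonZero (sym (+-suc m n)) _

  -- A downward step in the index. Inserting the bound for `c` into the recurrence gives (1 + h)(h +
  -- 2i) a ≥ i (h + 2i + 1) b; dropping i b leaves the common factor h + 2i.
  ratioUpper-step : ∀ i h a b c .{{_ : NonZero i}} →
    i * (1 + i) * c + (1 + h) * (h + i + i) * a ≡ i * (1 + 2 * (h + i)) * b →
    (1 + i) * c ≤ h * b → i * b ≤ (1 + h) * a
  ratioUpper-step i@(suc _) h a b c rec hyp = *-cancelʳ-≤ (i * b) ((1 + h) * a) (h + i + i)
    {{m+n≢0 (h + i) i}} (+-cancelʳ-≤ (i * (h * b)) _ _ (begin
    i * b * (h + i + i) + i * (h * b)               ≤⟨ ≤-fromSlack (i * b) (regroup₁ i h b) ⟩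
    i * (1 + 2 * (h + i)) * b                       ≡⟨ rec ⟨
    i * (1 + i) * c + (1 + h) * (h + i + i) * a     ≡⟨ regroup₂ i h a c ⟩
    (1 + h) * a * (h + i + i) + i * ((1 + i) * c)   ≤⟨ +-monoʳ-≤ ((1 + h) * a * (h + i + i)) (*-monoʳ-≤ i hyp) ⟩
    (1 + h) * a * (h + i + i) + i * (h * b) ∎))
    where
    open ≤-Reasoning
    regroup₁ : ∀ i h b → i * b * (h + i + i) + i * (h * b) + i * b ≡ i * (1 + 2 * (h + i)) * b
    regroup₁ = solve-∀
    regroup₂ : ∀ i h a c → i * (1 + i) * c + (1 + h) * (h + i + i) * a ≡
      (1 + h) * a * (h + i + i) + i * ((1 + i) * c)
    regroup₂ = solve-∀

  -- A downward step again. Multiplying the recurrence by 6 + 4i = 2(2i + 3) clears the denominator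
  -- of c ≥ 2hb / (2i + 3), and 3hb is left over.
  ratioLower-step : ∀ i h a b c .{{_ : NonZero i}} →
    i * (1 + i) * c + (1 + h) * (h + i + i) * a ≡ i * (1 + 2 * (h + i)) * b →
    2 * h * b ≤ (1 + 2 * (1 + i)) * c → 2 * (1 + h) * a ≤ (1 + 2 * i) * b
  ratioLower-step i@(suc _) h a b c rec hyp = *-cancelʳ-≤ _ _ ((3 + 2 * i) * (h + i + i))
    {{m*n≢0 (3 + 2 * i) (h + i + i) {{_}} {{m+n≢0 (h + i) i}}}}
    (+-cancelʳ-≤ (2 * i * (1 + i) * (2 * h * b)) _ _ (begin
    2 * (1 + h) * a * ((3 + 2 * i) * (h + i + i)) + 2 * i * (1 + i) * (2 * h * b)
      ≤⟨ +-monoʳ-≤ (2 * (1 + h) * a * ((3 + 2 * i) * (h + i + i))) (*-monoʳ-≤ (2 * i * (1 + i)) hyp) ⟩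
    2 * (1 + h) * a * ((3 + 2 * i) * (h + i + i)) + 2 * i * (1 + i) * ((1 + 2 * (1 + i)) * c)
      ≡⟨ regroup₁ i h a c ⟩
    (6 + 4 * i) * (i * (1 + i) * c + (1 + h) * (h + i + i) * a)
      ≡⟨ cong ((6 + 4 * i) *_) rec ⟩
    (6 + 4 * i) * (i * (1 + 2 * (h + i)) * b)
      ≤⟨ ≤-fromSlack (3 * h * b) (regroup₂ i h b) ⟩
    (1 + 2 * i) * b * ((3 + 2 * i) * (h + i + i)) + 2 * i * (1 + i) * (2 * h * b) ∎))
    where
    open ≤-Reasoning
    regroup₁ : ∀ i h a c →
      2 * (1 + h) * a * ((3 + 2 * i) * (h + i + i)) + 2 * i * (1 + i) * ((1 + 2 * (1 + i)) * c) ≡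
      (6 + 4 * i) * (i * (1 + i) * c + (1 + h) * (h + i + i) * a)
    regroup₁ = solve-∀
    regroup₂ : ∀ i h b → (6 + 4 * i) * (i * (1 + 2 * (h + i)) * b) + 3 * h * b ≡
      (1 + 2 * i) * b * ((3 + 2 * i) * (h + i + i)) + 2 * i * (1 + i) * (2 * h * b)
    regroup₂ = solve-∀

  -- The cubic inequality.

  -- What `weightedGap` becomes once `a` and `e` are eliminated. Since ρ G = p G + D² (2D + 3T) + D
  -- T², the left side has three parts. The parts in D² and T² are absorbed by the ρ p² and p b²
  -- terms through the bound on D, and p G by its larger multiple on the right.
  cubic-bound : ∀ i b p D → 2 * (1 + i) * D ≤ p →
    let T = (1 + 2 * i) * b ; G = D * (D + T) ; ρ = p + (2 * D + T) in
    i * i * (1 + i) * ρ * G ≤ (2 + 3 * i) * ρ * (p * p) + (1 + i) * (1 + i) * (2 + i) * p * (G + 2 * i * (b * b))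
  cubic-bound i b p D 2jD≤p = begin
    i * i * (1 + i) * (p + (2 * D + T)) * (D * (D + T))
      ≡⟨ regroup i p D T ⟩
    i * i * (1 + i) * (D * D * (2 * D + 3 * T)) + (i * i * ((1 + i) * p * G) + i * i * (1 + i) * D * (T * T))
      ≤⟨ +-mono-≤ cubeTerm (+-mono-≤ linearTerm squareTerm) ⟩
    (2 + 3 * i) * ρ * (p * p) + ((1 + i) * (2 + i) * ((1 + i) * p * G) + (1 + i) * (1 + i) * (2 + i) * p * (2 * i * (b * b)))
      ≡⟨ cong ((2 + 3 * i) * ρ * (p * p) +_) (collect i p G (2 * i * (b * b))) ⟩
    (2 + 3 * i) * ρ * (p * p) + (1 + i) * (1 + i) * (2 + i) * p * (G + 2 * i * (b * b)) ∎
    where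
    open ≤-Reasoning
    T = (1 + 2 * i) * b
    G = D * (D + T)
    ρ = p + (2 * D + T)
    regroup : ∀ i p D T → i * i * (1 + i) * (p + (2 * D + T)) * (D * (D + T)) ≡
      i * i * (1 + i) * (D * D * (2 * D + 3 * T)) +
      (i * i * ((1 + i) * p * (D * (D + T))) + i * i * (1 + i) * D * (T * T))
    regroup = solve-∀
    collect : ∀ i p G x → (1 + i) * (2 + i) * ((1 + i) * p * G) + (1 + i) * (1 + i) * (2 + i) * p * x ≡
      (1 + i) * (1 + i) * (2 + i) * p * (G + x)
    collect = solve-∀
    cubeSlack : ∀ i D T → i * i * (1 + i) * (D * D * (2 * D + 3 * T)) +
      (1 + i) * D * D * ((11 * i * i + 20 * i + 8) * (2 * D) + (9 * i * i + 20 * i + 8) * T) ≡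
      (2 + 3 * i) * (2 * D + T) * (2 * (1 + i) * D * (2 * (1 + i) * D))
    cubeSlack = solve-∀
    cubeTerm : i * i * (1 + i) * (D * D * (2 * D + 3 * T)) ≤ (2 + 3 * i) * ρ * (p * p)
    cubeTerm = ≤-trans (≤-fromSlack _ (cubeSlack i D T))
      (*-mono-≤ (*-monoʳ-≤ (2 + 3 * i) (m≤n+m (2 * D + T) p)) (*-mono-≤ 2jD≤p 2jD≤p))
    linearTerm : i * i * ((1 + i) * p * G) ≤ (1 + i) * (2 + i) * ((1 + i) * p * G)
    linearTerm = *-monoˡ-≤ ((1 + i) * p * G) (*-mono-≤ (m≤n+m i 1) (m≤n+m i 2))
    squareSlack : ∀ i b D → i * i * (1 + i) * D * ((1 + 2 * i) * b * ((1 + 2 * i) * b)) +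
      i * (1 + i) * D * (b * b) * (12 * i * i + 19 * i + 8) ≡
      (1 + i) * (1 + i) * (2 + i) * (2 * (1 + i) * D) * (2 * i * (b * b))
    squareSlack = solve-∀
    squareTerm : i * i * (1 + i) * D * (T * T) ≤ (1 + i) * (1 + i) * (2 + i) * p * (2 * i * (b * b))
    squareTerm = ≤-trans (≤-fromSlack _ (squareSlack i b D))
      (*-monoˡ-≤ (2 * i * (b * b)) (*-monoʳ-≤ ((1 + i) * (1 + i) * (2 + i)) 2jD≤p))

  -- D measures the defect in j c ≤ h b. Since h b = p + D, every quantity of degree two in
  -- (a , b , c , e) becomes free of h when written in p = j c, D and b.
  module Consecutive (i h a b c e D : ℕ)
    (rec₁ : i * (1 + i) * c + (1 + h) * (h + i + i) * a ≡ i * (1 + 2 * (h + i)) * b)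
    (rec₂ : (1 + i) * (2 + i) * e + h * (h + i + (1 + i)) * b ≡ (1 + i) * (1 + 2 * (h + i)) * c)
    (hb≡p+D : h * b ≡ (1 + i) * c + D) (2D≤c : 2 * D ≤ c) where

    -- `V` is the coefficient of `a` in `rec₁`, and `ρ` is chosen so that V a = i ρ. `G` is the
    -- amount by which (1 + i)(2 + i) e b falls short of p².
    p T G ρ V : ℕ
    p = (1 + i) * c
    T = (1 + 2 * i) * b
    G = D * (D + T)
    ρ = p + (2 * D + T)
    V = (1 + h) * (h + i + i)

    Va≡iρ : V * a ≡ i * ρ
    Va≡iρ = +-cancelˡ-≡ (i * p) _ _ (begin
      i * p + V * a                    ≡⟨ cong (_+ V * a) (*-assoc i (1 + i) c) ⟨
      i * (1 + i) * c + V * a          ≡⟨ rec₁ ⟩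
      i * (1 + 2 * (h + i)) * b        ≡⟨ regroup₁ i h b ⟩
      i * (2 * (h * b) + T)            ≡⟨ cong (λ x → i * (2 * x + T)) hb≡p+D ⟩
      i * (2 * (p + D) + T)            ≡⟨ regroup₂ i p D T ⟩
      i * p + i * ρ ∎)
      where
      open ≡-Reasoning
      regroup₁ : ∀ i h b → i * (1 + 2 * (h + i)) * b ≡ i * (2 * (h * b) + (1 + 2 * i) * b)
      regroup₁ = solve-∀
      regroup₂ : ∀ i p D T → i * (2 * (p + D) + T) ≡ i * p + i * (p + (2 * D + T))
      regroup₂ = solve-∀

    -- After multiplication by `b`, `rec₂` contains h only through the product h b, which is p + D.
    eb+G≡p² : (1 + i) * (2 + i) * e * b + G ≡ p * p
    eb+G≡p² = +-cancelˡ-≡ (p * p + 2 * p * D + p * T) _ _ (begin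
      p * p + 2 * p * D + p * T + ((1 + i) * (2 + i) * e * b + G)
        ≡⟨ regroup₁ p D T ((1 + i) * (2 + i) * e * b) ⟩
      (1 + i) * (2 + i) * e * b + (p + D) * (p + D + T)
        ≡⟨ cong (λ x → (1 + i) * (2 + i) * e * b + x * (x + T)) hb≡p+D ⟨
      (1 + i) * (2 + i) * e * b + h * b * (h * b + T)
        ≡⟨ regroup₂ i h b ((1 + i) * (2 + i) * e) ⟩
      ((1 + i) * (2 + i) * e + h * (h + i + (1 + i)) * b) * b
        ≡⟨ cong (_* b) rec₂ ⟩
      (1 + i) * (1 + 2 * (h + i)) * c * b
        ≡⟨ regroup₃ i h b c ⟩
      p * (2 * (h * b) + T)
        ≡⟨ cong (λ x → p * (2 * x + T)) hb≡p+D ⟩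
      p * (2 * (p + D) + T)
        ≡⟨ regroup₄ p D T ⟩
      p * p + 2 * p * D + p * T + p * p ∎)
      where
      open ≡-Reasoning
      regroup₁ : ∀ p D T x → p * p + 2 * p * D + p * T + (x + D * (D + T)) ≡ x + (p + D) * (p + D + T)
      regroup₁ = solve-∀
      regroup₂ : ∀ i h b x → x * b + h * b * (h * b + (1 + 2 * i) * b) ≡ (x + h * (h + i + (1 + i)) * b) * b
      regroup₂ = solve-∀
      regroup₃ : ∀ i h b c → (1 + i) * (1 + 2 * (h + i)) * c * b ≡ (1 + i) * c * (2 * (h * b) + (1 + 2 * i) * b)
      regroup₃ = solve-∀
      regroup₄ : ∀ p D T → p * (2 * (p + D) + T) ≡ p * p + 2 * p * D + p * T + p * p
      regroup₄ = solve-∀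

    Vb²≡ : V * (b * b) ≡ p * ρ + (G + 2 * i * (b * b))
    Vb²≡ = begin
      V * (b * b)                                ≡⟨ regroup₁ i h b ⟩
      h * b * (h * b + T) + 2 * i * (b * b)      ≡⟨ cong (λ x → x * (x + T) + 2 * i * (b * b)) hb≡p+D ⟩
      (p + D) * (p + D + T) + 2 * i * (b * b)    ≡⟨ regroup₂ p D T (2 * i * (b * b)) ⟩
      p * ρ + (G + 2 * i * (b * b)) ∎
      where
      open ≡-Reasoning
      regroup₁ : ∀ i h b → (1 + h) * (h + i + i) * (b * b) ≡ h * b * (h * b + (1 + 2 * i) * b) + 2 * i * (b * b)
      regroup₁ = solve-∀
      regroup₂ : ∀ p D T x → (p + D) * (p + D + T) + x ≡ p * (p + (2 * D + T)) + (D * (D + T) + x)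
      regroup₂ = solve-∀

    module _ .{{_ : NonZero V}} where

      -- Multiplied by `V`, the two sides become i p ρ and i (p ρ + G + 2 i b²).
      [1+i]ac≤ib² : (1 + i) * (a * c) ≤ i * (b * b)
      [1+i]ac≤ib² = *-cancelˡ-≤ V (begin
        V * ((1 + i) * (a * c))      ≡⟨ regroup₁ V i a c ⟩
        p * (V * a)                  ≡⟨ cong (p *_) Va≡iρ ⟩
        p * (i * ρ)                  ≤⟨ ≤-fromSlack (i * (G + 2 * i * (b * b))) (regroup₂ i p ρ _) ⟩
        i * (p * ρ + (G + 2 * i * (b * b)))  ≡⟨ cong (i *_) Vb²≡ ⟨
        i * (V * (b * b))            ≡⟨ regroup₃ i V (b * b) ⟩
        V * (i * (b * b)) ∎)
        where
        open ≤-Reasoning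
        regroup₁ : ∀ V i a c → V * ((1 + i) * (a * c)) ≡ (1 + i) * c * (V * a)
        regroup₁ = solve-∀
        regroup₂ : ∀ i p ρ x → p * (i * ρ) + i * x ≡ i * (p * ρ + x)
        regroup₂ = solve-∀
        regroup₃ : ∀ i V x → i * (V * x) ≡ V * (i * x)
        regroup₃ = solve-∀

      -- Multiplying by V (1 + i)² (2 + i) allows V a, V b² and (1 + i)(2 + i) e b to be
      -- substituted. The ρ p² terms then balance up to (2 + 3i) ρ p² on the right, and the rest is
      -- `cubic-bound`.
      weightedGap : (1 + 2 * i) * (a * (c * c)) ≤ (1 + i) * (c * (b * b)) + i * (a * (b * e))
      weightedGap = *-cancelˡ-≤ (V * ((1 + i) * (1 + i) * (2 + i)))
        {{m*n≢0 V ((1 + i) * (1 + i) * (2 + i))}}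
        -- Added on both sides because e b is proportional to p² - G, whose negative part must be
        -- moved across.
        (+-cancelʳ-≤ (i * i * (1 + i) * ρ * G) _ _ (begin
        V * ((1 + i) * (1 + i) * (2 + i)) * ((1 + 2 * i) * (a * (c * c))) + g
          ≡⟨ cong (_+ g) (regroup₁ V i a c) ⟩
        (1 + 2 * i) * (2 + i) * (V * a) * (p * p) + g
          ≡⟨ cong (λ x → (1 + 2 * i) * (2 + i) * x * (p * p) + g) Va≡iρ ⟩
        (1 + 2 * i) * (2 + i) * (i * ρ) * (p * p) + g
          ≤⟨ +-monoʳ-≤ ((1 + 2 * i) * (2 + i) * (i * ρ) * (p * p)) (cubic-bound i b p D 2jD≤p) ⟩
        (1 + 2 * i) * (2 + i) * (i * ρ) * (p * p) +
          ((2 + 3 * i) * ρ * (p * p) + (1 + i) * (1 + i) * (2 + i) * p * (G + 2 * i * (b * b)))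
          ≡⟨ regroup₂ i p ρ (G + 2 * i * (b * b)) ⟩
        (1 + i) * (1 + i) * (2 + i) * p * (p * ρ + (G + 2 * i * (b * b))) + i * (1 + i) * (i * ρ) * (p * p)
          ≡⟨ cong₂ (λ x y → (1 + i) * (1 + i) * (2 + i) * p * x + i * (1 + i) * (i * ρ) * y) Vb²≡ eb+G≡p² ⟨
        (1 + i) * (1 + i) * (2 + i) * p * (V * (b * b)) +
          i * (1 + i) * (i * ρ) * ((1 + i) * (2 + i) * e * b + G)
          ≡⟨ regroup₃ i ρ G _ ((1 + i) * (2 + i) * e * b) ⟩
        (1 + i) * (1 + i) * (2 + i) * p * (V * (b * b)) +
          i * (1 + i) * ((1 + i) * (2 + i) * e * b) * (i * ρ) + g
          ≡⟨ cong (λ x → (1 + i) * (1 + i) * (2 + i) * p * (V * (b * b)) +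
               i * (1 + i) * ((1 + i) * (2 + i) * e * b) * x + g) Va≡iρ ⟨
        (1 + i) * (1 + i) * (2 + i) * p * (V * (b * b)) +
          i * (1 + i) * ((1 + i) * (2 + i) * e * b) * (V * a) + g
          ≡⟨ cong (_+ g) (regroup₄ V i a b c e) ⟩
        V * ((1 + i) * (1 + i) * (2 + i)) * ((1 + i) * (c * (b * b)) + i * (a * (b * e))) + g ∎))
        where
        open ≤-Reasoning
        g = i * i * (1 + i) * ρ * G
        2jD≤p : 2 * (1 + i) * D ≤ p
        2jD≤p = ≤-trans (≤-reflexive (swap i D)) (*-monoʳ-≤ (1 + i) 2D≤c)
          where
          swap : ∀ i D → 2 * (1 + i) * D ≡ (1 + i) * (2 * D)
          swap = solve-∀
        regroup₁ : ∀ V i a c → V * ((1 + i) * (1 + i) * (2 + i)) * ((1 + 2 * i) * (a * (c * c))) ≡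
          (1 + 2 * i) * (2 + i) * (V * a) * ((1 + i) * c * ((1 + i) * c))
        regroup₁ = solve-∀
        regroup₂ : ∀ i p ρ x → (1 + 2 * i) * (2 + i) * (i * ρ) * (p * p) +
          ((2 + 3 * i) * ρ * (p * p) + (1 + i) * (1 + i) * (2 + i) * p * x) ≡
          (1 + i) * (1 + i) * (2 + i) * p * (p * ρ + x) + i * (1 + i) * (i * ρ) * (p * p)
        regroup₂ = solve-∀
        regroup₃ : ∀ i ρ G x y → x + i * (1 + i) * (i * ρ) * (y + G) ≡
          x + i * (1 + i) * y * (i * ρ) + i * i * (1 + i) * ρ * G
        regroup₃ = solve-∀
        regroup₄ : ∀ V i a b c e → (1 + i) * (1 + i) * (2 + i) * ((1 + i) * c) * (V * (b * b)) +
          i * (1 + i) * ((1 + i) * (2 + i) * e * b) * (V * a) ≡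
          V * ((1 + i) * (1 + i) * (2 + i)) * ((1 + i) * (c * (b * b)) + i * (a * (b * e)))
        regroup₄ = solve-∀

  -- From the weighted inequalities to the normalized gap.

  -- Put y = b², z = a c and s = i y - (1 + i) z ≥ 0. Then i (y z + z²) = z s + (1 + 2i) z². Here z
  -- s ≤ y s, and `a` times the second hypothesis bounds (1 + 2i) z²; the sum of the two bounds is i
  -- (y² + a² b e).
  gap-fromWeighted : ∀ i a b c e .{{_ : NonZero i}} →
    (1 + i) * (a * c) ≤ i * (b * b) →
    (1 + 2 * i) * (a * (c * c)) ≤ (1 + i) * (c * (b * b)) + i * (a * (b * e)) →
    a * c ≤ b * b ×
    b * b * (a * c) + a * c * (a * c) ≤ b * b * (b * b) + a * a * (b * e)
  gap-fromWeighted i a b c e hyp₁ hyp₂ = ac≤b² , *-cancelˡ-≤ i (begin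
    i * (y * z + z * z)                       ≡⟨ regroup₁ i y z ⟩
    z * (i * y) + i * (z * z)                 ≡⟨ cong (λ x → z * x + i * (z * z)) (proj₂ split) ⟨
    z * ((1 + i) * z + s) + i * (z * z)       ≡⟨ regroup₂ i z s ⟩
    z * s + (1 + 2 * i) * (z * z)             ≡⟨ cong (z * s +_) (regroup₃ i a c) ⟩
    z * s + a * ((1 + 2 * i) * (a * (c * c))) ≤⟨ +-mono-≤ (*-monoˡ-≤ s ac≤b²) (*-monoʳ-≤ a hyp₂) ⟩
    y * s + a * ((1 + i) * (c * y) + i * (a * (b * e)))
                                              ≡⟨ regroup₄ i s a c y (b * e) ⟩
    y * ((1 + i) * z + s) + i * (a * a * (b * e))
                                              ≡⟨ cong (λ x → y * x + i * (a * a * (b * e))) (proj₂ split) ⟩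
    y * (i * y) + i * (a * a * (b * e))       ≡⟨ regroup₅ i y (a * a * (b * e)) ⟩
    i * (y * y + a * a * (b * e)) ∎)
    where
    open ≤-Reasoning
    y = b * b
    z = a * c
    split = m≤n⇒∃[o]m+o≡n hyp₁
    s = proj₁ split
    ac≤b² : z ≤ y
    ac≤b² = *-cancelˡ-≤ i (≤-trans (m≤n+m (i * z) z) hyp₁)
    regroup₁ : ∀ i y z → i * (y * z + z * z) ≡ z * (i * y) + i * (z * z)
    regroup₁ = solve-∀
    regroup₂ : ∀ i z s → z * ((1 + i) * z + s) + i * (z * z) ≡ z * s + (1 + 2 * i) * (z * z)
    regroup₂ = solve-∀
    regroup₃ : ∀ i a c → (1 + 2 * i) * (a * c * (a * c)) ≡ a * ((1 + 2 * i) * (a * (c * c)))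
    regroup₃ = solve-∀
    regroup₄ : ∀ i s a c y w → y * s + a * ((1 + i) * (c * y) + i * (a * w)) ≡
      y * ((1 + i) * (a * c) + s) + i * (a * a * w)
    regroup₄ = solve-∀
    regroup₅ : ∀ i y w → y * (i * y) + i * w ≡ i * (y * y + w)
    regroup₅ = solve-∀

  -- A, B, Γ, e are the normalized numbers multiplied by 4ᵐ (N + 2)!.
  gap-normalized : ∀ N a b c e .{{_ : NonZero b}} → a * c ≤ b * b →
    b * b * (a * c) + a * c * (a * c) ≤ b * b * (b * b) + a * a * (b * e) →
    let A = N * (1 + N) * (2 + N) * a ; B = (1 + N) * (2 + N) * b ; Γ = (2 + N) * c in
    A * A * (Γ * Γ) + B * B * (A * Γ) < B * B * (B * B) + A * A * (B * e)
  gap-normalized N a b c e ac≤b² gap = begin-strict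
    A * A * (Γ * Γ) + B * B * (A * Γ)
      ≡⟨ regroup₁ N a b c ⟩
    -- Beyond the common factor `k`, the multiple N² (1 + N) of `gap` is split off. The remaining
    -- terms are compared by z ≤ y, with surplus (2 + 3N) y² > 0.
    k * (N * N * (1 + N) * (y * z + z * z) + (N * N * 2 + N * 2) * (y * z) + N * N * (z * z))
      <⟨ *-monoʳ-< k (begin-strict
      N * N * (1 + N) * (y * z + z * z) + (N * N * 2 + N * 2) * (y * z) + N * N * (z * z)
        ≤⟨ +-mono-≤ (+-mono-≤ (*-monoʳ-≤ (N * N * (1 + N)) gap)
             (*-monoʳ-≤ (N * N * 2 + N * 2) (*-monoʳ-≤ y ac≤b²))) (*-monoʳ-≤ (N * N) (*-mono-≤ ac≤b² ac≤b²)) ⟩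
      N * N * (1 + N) * (y * y + a * a * (b * e)) + (N * N * 2 + N * 2) * (y * y) + N * N * (y * y)
        <⟨ m<m+n _ y²>0 ⟩
      N * N * (1 + N) * (y * y + a * a * (b * e)) + (N * N * 2 + N * 2) * (y * y) + N * N * (y * y) + y * y
        ≤⟨ m≤m+n _ ((1 + 3 * N) * (y * y)) ⟩
      N * N * (1 + N) * (y * y + a * a * (b * e)) + (N * N * 2 + N * 2) * (y * y) + N * N * (y * y) + y * y
        + (1 + 3 * N) * (y * y) ∎) ⟩
    k * (N * N * (1 + N) * (y * y + a * a * (b * e)) + (N * N * 2 + N * 2) * (y * y) + N * N * (y * y) + y * y
        + (1 + 3 * N) * (y * y))
      ≡⟨ regroup₂ N a b e ⟩
    B * B * (B * B) + A * A * (B * e) ∎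
    where
    open ≤-Reasoning
    A = N * (1 + N) * (2 + N) * a
    B = (1 + N) * (2 + N) * b
    Γ = (2 + N) * c
    y = b * b
    z = a * c
    k = (1 + N) * (1 + N) * ((2 + N) * (2 + N) * (2 + N))
    y²>0 : 0 < y * y
    y²>0 = >-nonZero⁻¹ (y * y) {{m*n≢0 y y {{m*n≢0 b b}} {{m*n≢0 b b}}}}
    regroup₁ : ∀ N a b c →
      N * (1 + N) * (2 + N) * a * (N * (1 + N) * (2 + N) * a) * ((2 + N) * c * ((2 + N) * c)) +
      (1 + N) * (2 + N) * b * ((1 + N) * (2 + N) * b) * (N * (1 + N) * (2 + N) * a * ((2 + N) * c)) ≡
      (1 + N) * (1 + N) * ((2 + N) * (2 + N) * (2 + N)) *
      (N * N * (1 + N) * (b * b * (a * c) + a * c * (a * c)) + (N * N * 2 + N * 2) * (b * b * (a * c)) + N * N * (a * c * (a * c)))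
    regroup₁ = solve-∀
    regroup₂ : ∀ N a b e →
      (1 + N) * (1 + N) * ((2 + N) * (2 + N) * (2 + N)) *
      (N * N * (1 + N) * (b * b * (b * b) + a * a * (b * e)) + (N * N * 2 + N * 2) * (b * b * (b * b))
        + N * N * (b * b * (b * b)) + b * b * (b * b) + (1 + 3 * N) * (b * b * (b * b))) ≡
      (1 + N) * (2 + N) * b * ((1 + N) * (2 + N) * b) * ((1 + N) * (2 + N) * b * ((1 + N) * (2 + N) * b)) +
      N * (1 + N) * (2 + N) * a * (N * (1 + N) * (2 + N) * a) * ((1 + N) * (2 + N) * b * e)
    regroup₂ = solve-∀

  -- Application to the numerators.

  -- Collects both multiples of S at index l by m(m + 1) - l(l + 1) = (m - l)(m + l + 1), which
  -- gives the shape of `rec₁` with i = l + 1 and h = m - i.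
  numerator-recurrence′ : ∀ m h l → h + suc l ≡ m →
    suc l * (1 + suc l) * numerator m (2 + l) + (1 + h) * (m + suc l) * numerator m l ≡
    suc l * (1 + 2 * m) * numerator m (suc l)
  numerator-recurrence′ m h l refl = +-cancelˡ-≡ (l * (1 + l) * numerator m l) _ _
    (trans (regroup h l (numerator m l) ((1 + l) * (2 + l) * numerator m (2 + l))) (numerator-recurrence m l))
    where
    regroup : ∀ h l x y → l * (1 + l) * x + (y + (1 + h) * (h + (1 + l) + (1 + l)) * x) ≡
      y + (h + (1 + l)) * (1 + (h + (1 + l))) * x
    regroup = solve-∀

  numerator-vanishes : ∀ m → numerator m (suc m) ≡ 0
  numerator-vanishes m = trans (sym (numerator-sumFromTo m (suc m) ≤-refl)) empty
    where
    empty : sumFromTo (suc m) m (λ j → weight m j * (j C suc m)) ≡ 0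
    empty rewrite n∸n≡0 m = refl

  -- Induction on h = m - l, hence downward in the index, starting from Sₘ₊₁ = 0.
  ratioBounds : ∀ m h l → h + l ≡ m →
    suc l * numerator m (suc l) ≤ h * numerator m l ×
    2 * h * numerator m l ≤ (1 + 2 * suc l) * numerator m (suc l)
  ratioBounds m zero    l refl =
    ≤-reflexive (trans (cong (suc l *_) (numerator-vanishes l)) (*-zeroʳ l)) , z≤n
  ratioBounds m (suc h) l eq with trans (+-suc h l) eq
  ... | refl =
    let upper , lower = ratioBounds m h (suc l) refl
        rec = numerator-recurrence′ m h l refl
    in ratioUpper-step (suc l) h (numerator m l) (numerator m (suc l)) (numerator m (2 + l)) rec upper ,
       ratioLower-step (suc l) h (numerator m l) (numerator m (suc l)) (numerator m (2 + l)) rec lower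

  C>0 : ∀ {n k} → k ≤ n → 0 < n C k
  C>0 {n}     z≤n           = s≤s z≤n
  C>0 {suc n} (s≤s {k} k≤n) = subst (0 <_) (nCk+nC[k+1]≡[n+1]C[k+1] n k)
    (<-≤-trans (C>0 k≤n) (m≤m+n (n C k) (n C suc k)))

  -- The summand j = m alone is positive.
  numerator≢0 : ∀ m i → i ≤ m → NonZero (numerator m i)
  numerator≢0 m i i≤m = >-nonZero (<-≤-trans
    (*-mono-< (*-mono-< (*-mono-< (m^n>0 2 m) central) (C>0 (m≤n+m m m))) (C>0 i≤m))
    (m≤n+m _ (partialNumerator m m i)))
    where
    central : 0 < (2 * m ∸ 2 * m) C (m ∸ m)
    central = C>0 (≤-trans (≤-reflexive (n∸n≡0 m)) z≤n)

  numerator-gap : ∀ m h l → suc h + suc l ≡ m →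
    let a = numerator m l ; b = numerator m (suc l) ; c = numerator m (2 + l) ; e = numerator m (3 + l) in
    a * c ≤ b * b ×
    b * b * (a * c) + a * c * (a * c) ≤ b * b * (b * b) + a * a * (b * e)
  numerator-gap m h l refl = gap-fromWeighted i a b c e [1+i]ac≤ib² weightedGap
    where
    i = suc l
    a = numerator m l
    b = numerator m i
    c = numerator m (suc i)
    e = numerator m (2 + i)
    bounds = ratioBounds m (suc h) i refl
    -- The upper ratio bound makes D = (m - i) b - (1 + i) c a natural number; the lower one is
    -- equivalent to 2 D ≤ c.
    excess = m≤n⇒∃[o]m+o≡n (proj₁ bounds)
    D = proj₁ excess
    2D≤c : 2 * D ≤ c
    2D≤c = +-cancelˡ-≤ (2 * ((1 + i) * c)) _ _ (begin
      2 * ((1 + i) * c) + 2 * D  ≡⟨ *-distribˡ-+ 2 ((1 + i) * c) D ⟨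
      2 * ((1 + i) * c + D)      ≡⟨ cong (2 *_) (proj₂ excess) ⟩
      2 * (suc h * b)            ≡⟨ *-assoc 2 (suc h) b ⟨
      2 * suc h * b              ≤⟨ proj₂ bounds ⟩
      (1 + 2 * suc i) * c        ≡⟨ regroup i c ⟩
      2 * ((1 + i) * c) + c ∎)
      where
      open ≤-Reasoning
      regroup : ∀ i c → (1 + 2 * (1 + i)) * c ≡ 2 * ((1 + i) * c) + c
      regroup = solve-∀
    open Consecutive i (suc h) a b c e D (numerator-recurrence′ m (suc h) l refl)
      (numerator-recurrence′ m h i (+-suc h i)) (sym (proj₂ excess)) 2D≤c

open Inequalities

-- Fractions of natural numbers.

open import Data.Integer.Base as ℤ using (+_)
import Data.Integer.Properties as ℤ
open import Data.Rational.Base using (_/_; _+_; _*_; _-_; -_; _<_; _>_; toℚᵘ; fromℚᵘ)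
open import Data.Rational.Properties using (+-monoˡ-<; toℚᵘ-injective; toℚᵘ-homo-*; toℚᵘ-homo-+; toℚᵘ-fromℚᵘ; fromℚᵘ-cong; toℚᵘ-cancel-<)
import Data.Rational.Solver as ℚ
import Data.Rational.Unnormalised.Base as ℚᵘ
import Data.Rational.Unnormalised.Properties as ℚᵘ

-- `+ p / q` is by definition `fromℚᵘ` of an unnormalised fraction, where equality is
-- cross-multiplication and no gcd has to be computed.
frac-≡ : ∀ p q r s .{{_ : NonZero q}} .{{_ : NonZero s}} → p ℕ.* s ≡ r ℕ.* q → + p / q ≡ + r / s
frac-≡ p q@(suc _) r s@(suc _) eq = fromℚᵘ-cong {ℚᵘ.mkℚᵘ (+ p) _} {ℚᵘ.mkℚᵘ (+ r) _}
  (ℚᵘ.*≡* (trans (sym (ℤ.pos-* p s)) (trans (cong +_ eq) (ℤ.pos-* r q))))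

fromℚᵘ-homo-* : ∀ u v → fromℚᵘ u * fromℚᵘ v ≡ fromℚᵘ (u ℚᵘ.* v)
fromℚᵘ-homo-* u v = toℚᵘ-injective (begin
  toℚᵘ (fromℚᵘ u * fromℚᵘ v)              ≈⟨ toℚᵘ-homo-* (fromℚᵘ u) (fromℚᵘ v) ⟩
  toℚᵘ (fromℚᵘ u) ℚᵘ.* toℚᵘ (fromℚᵘ v)    ≈⟨ ℚᵘ.*-cong (toℚᵘ-fromℚᵘ u) (toℚᵘ-fromℚᵘ v) ⟩
  u ℚᵘ.* v                                ≈⟨ toℚᵘ-fromℚᵘ (u ℚᵘ.* v) ⟨
  toℚᵘ (fromℚᵘ (u ℚᵘ.* v)) ∎)
  where open import Relation.Binary.Reasoning.Setoid ℚᵘ.≃-setoid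

fromℚᵘ-homo-+ : ∀ u v → fromℚᵘ u + fromℚᵘ v ≡ fromℚᵘ (u ℚᵘ.+ v)
fromℚᵘ-homo-+ u v = toℚᵘ-injective (begin
  toℚᵘ (fromℚᵘ u + fromℚᵘ v)              ≈⟨ toℚᵘ-homo-+ (fromℚᵘ u) (fromℚᵘ v) ⟩
  toℚᵘ (fromℚᵘ u) ℚᵘ.+ toℚᵘ (fromℚᵘ v)    ≈⟨ ℚᵘ.+-cong (toℚᵘ-fromℚᵘ u) (toℚᵘ-fromℚᵘ v) ⟩
  u ℚᵘ.+ v                                ≈⟨ toℚᵘ-fromℚᵘ (u ℚᵘ.+ v) ⟨
  toℚᵘ (fromℚᵘ (u ℚᵘ.+ v)) ∎)
  where open import Relation.Binary.Reasoning.Setoid ℚᵘ.≃-setoid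

frac-* : ∀ p q r s .{{_ : NonZero q}} .{{_ : NonZero s}} →
  (+ p / q) * (+ r / s) ≡ (+ (p ℕ.* r) / (q ℕ.* s)) {{ℕ.m*n≢0 q s}}
frac-* p q@(suc q′) r s@(suc s′) = trans (fromℚᵘ-homo-* (ℚᵘ.mkℚᵘ (+ p) q′) (ℚᵘ.mkℚᵘ (+ r) s′))
  (cong (λ x → x / (q ℕ.* s)) (sym (ℤ.pos-* p r)))

frac-+ : ∀ p r q .{{_ : NonZero q}} → (+ p / q) + (+ r / q) ≡ + (p ℕ.+ r) / q
frac-+ p r q@(suc q′) = trans (fromℚᵘ-homo-+ (ℚᵘ.mkℚᵘ (+ p) q′) (ℚᵘ.mkℚᵘ (+ r) q′))
  (trans (cong (λ x → x / (q ℕ.* q)) numer)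
    (frac-≡ (p ℕ.* q ℕ.+ r ℕ.* q) (q ℕ.* q) (p ℕ.+ r) q (regroup p q r)))
  where
  numer : + p ℤ.* + q ℤ.+ + r ℤ.* + q ≡ + (p ℕ.* q ℕ.+ r ℕ.* q)
  numer = trans (cong₂ ℤ._+_ (sym (ℤ.pos-* p q)) (sym (ℤ.pos-* r q))) (sym (ℤ.pos-+ (p ℕ.* q) (r ℕ.* q)))
  regroup : ∀ p q r → (p ℕ.* q ℕ.+ r ℕ.* q) ℕ.* q ≡ (p ℕ.+ r) ℕ.* (q ℕ.* q)
  regroup = solve-∀

frac-< : ∀ p r q .{{_ : NonZero q}} → p ℕ.< r → + p / q < + r / q
frac-< p r q@(suc q′) p<r = toℚᵘ-cancel-< (ℚᵘ.<-respˡ-≃ (ℚᵘ.≃-sym (toℚᵘ-fromℚᵘ (ℚᵘ.mkℚᵘ (+ p) q′)))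
  (ℚᵘ.<-respʳ-≃ (ℚᵘ.≃-sym (toℚᵘ-fromℚᵘ (ℚᵘ.mkℚᵘ (+ r) q′)))
  (ℚᵘ.*<* (ℤ.*-monoʳ-<-pos (+ q) (ℤ.+<+ p<r)))))

-- The inequality for the normalized Boros-Moll numbers.

-- `g` is the factor that raises the denominator 4ᵐ (i + k)! to the common one. The index m + 1 is
-- allowed because the fourth number of a window can reach it.
d̃-frac : ∀ i k m g Q .{{_ : NonZero Q}} → i ℕ.≤ suc m → Q ≡ 2 ^ (2 ℕ.* m) ℕ.* ((i ℕ.+ k) ! ℕ.* g) →
  d̃ i k m ≡ + (g ℕ.* numerator m i) / Q
d̃-frac i k m g Q i≤1+m Q≡ = trans (frac-* S P 1 F)
  (frac-≡ (S ℕ.* 1) (P ℕ.* F) (g ℕ.* numerator m i) Q (begin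
    S ℕ.* 1 ℕ.* Q                              ≡⟨ cong₂ (λ x y → x ℕ.* 1 ℕ.* y) (numerator-sumFromTo m i i≤1+m) Q≡ ⟩
    numerator m i ℕ.* 1 ℕ.* (P ℕ.* (F ℕ.* g))  ≡⟨ regroup (numerator m i) P F g ⟩
    g ℕ.* numerator m i ℕ.* (P ℕ.* F) ∎))
  where
  open ≡-Reasoning
  S = sumFromTo i m (λ j → weight m j ℕ.* (j C i))
  P = 2 ^ (2 ℕ.* m)
  F = (i ℕ.+ k) !
  instance
    _ = ℕ.m^n≢0 2 (2 ℕ.* m)
    _ = (i ℕ.+ k) ℕ.!≢0
    _ = ℕ.m*n≢0 P F
  regroup : ∀ n P F g → n ℕ.* 1 ℕ.* (P ℕ.* (F ℕ.* g)) ≡ g ℕ.* n ℕ.* (P ℕ.* F)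
  regroup = solve-∀

frac-gap : ∀ a b c e Q .{{_ : NonZero Q}} {α β γ ε} →
  α ≡ + a / Q → β ≡ + b / Q → γ ≡ + c / Q → ε ≡ + e / Q →
  a ℕ.* a ℕ.* (c ℕ.* c) ℕ.+ b ℕ.* b ℕ.* (a ℕ.* c) ℕ.< b ℕ.* b ℕ.* (b ℕ.* b) ℕ.+ a ℕ.* a ℕ.* (b ℕ.* e) →
  α ² * (γ ² - β * ε) < β ² * (β ² - α * γ)
frac-gap a b c e Q {α} {β} {γ} {ε} refl refl refl refl hyp = subst₂ _<_ (cancelˡ α β γ ε) (cancelʳ α β γ ε)
  -- Subtracting β² α γ + α² β ε from both sides of the subtraction-free inequality gives the
  -- claimed one.
  (+-monoˡ-< (- (β ² * (α * γ)) - α ² * (β * ε))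
    (subst₂ _<_ (sym (collect a a c c b b a c)) (sym (collect b b b b a a b e)) (frac-< _ _ Q⁴ hyp)))
  where
  instance
    _ : NonZero (Q ℕ.* Q)
    _ = ℕ.m*n≢0 Q Q
  Q⁴ = Q ℕ.* Q ℕ.* (Q ℕ.* Q)
  instance
    _ : NonZero Q⁴
    _ = ℕ.m*n≢0 (Q ℕ.* Q) (Q ℕ.* Q)
  product : ∀ w x y z → (+ w / Q) * (+ x / Q) * ((+ y / Q) * (+ z / Q)) ≡ + (w ℕ.* x ℕ.* (y ℕ.* z)) / Q⁴
  product w x y z = trans (cong₂ _*_ (frac-* w Q x Q) (frac-* y Q z Q))
    (frac-* (w ℕ.* x) (Q ℕ.* Q) (y ℕ.* z) (Q ℕ.* Q))
  collect : ∀ w x y z w′ x′ y′ z′ →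
    (+ w / Q) * (+ x / Q) * ((+ y / Q) * (+ z / Q)) + (+ w′ / Q) * (+ x′ / Q) * ((+ y′ / Q) * (+ z′ / Q)) ≡
    + (w ℕ.* x ℕ.* (y ℕ.* z) ℕ.+ w′ ℕ.* x′ ℕ.* (y′ ℕ.* z′)) / Q⁴
  collect w x y z w′ x′ y′ z′ = trans (cong₂ _+_ (product w x y z) (product w′ x′ y′ z′))
    (frac-+ (w ℕ.* x ℕ.* (y ℕ.* z)) (w′ ℕ.* x′ ℕ.* (y′ ℕ.* z′)) Q⁴)
  open ℚ.+-*-Solver
  cancelˡ : ∀ α β γ ε → α * α * (γ * γ) + β * β * (α * γ) + (- (β * β * (α * γ)) - α * α * (β * ε)) ≡
    α * α * (γ * γ - β * ε)
  cancelˡ = solve 4 (λ α β γ ε → α :* α :* (γ :* γ) :+ β :* β :* (α :* γ) :+ (:- (β :* β :* (α :* γ)) :- α :* α :* (β :* ε))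
    := α :* α :* (γ :* γ :- β :* ε)) refl
  cancelʳ : ∀ α β γ ε → β * β * (β * β) + α * α * (β * ε) + (- (β * β * (α * γ)) - α * α * (β * ε)) ≡
    β * β * (β * β - α * γ)
  cancelʳ = solve 4 (λ α β γ ε → β :* β :* (β :* β) :+ α :* α :* (β :* ε) :+ (:- (β :* β :* (α :* γ)) :- α :* α :* (β :* ε))
    := β :* β :* (β :* β :- α :* γ)) refl

d̃-gap : ∀ k m l → suc l ℕ.< m →
  d̃ l k m ² * (d̃ (2 ℕ.+ l) k m ² - d̃ (1 ℕ.+ l) k m * d̃ (3 ℕ.+ l) k m) <
  d̃ (1 ℕ.+ l) k m ² * (d̃ (1 ℕ.+ l) k m ² - d̃ l k m * d̃ (2 ℕ.+ l) k m)
d̃-gap k m l i<m =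
  -- With N = i + k, the multipliers are the quotients of (N + 2)! by (N - 1)!, N!, (N + 1)! and (N
  -- + 2)!.
  frac-gap (N ℕ.* (1 ℕ.+ N) ℕ.* (2 ℕ.+ N) ℕ.* a) ((1 ℕ.+ N) ℕ.* (2 ℕ.+ N) ℕ.* b) ((2 ℕ.+ N) ℕ.* c) e Q
    (d̃-frac l k m (N ℕ.* (1 ℕ.+ N) ℕ.* (2 ℕ.+ N)) Q (ℕ.m≤n⇒m≤1+n l≤m) (cong (P ℕ.*_) (factorial₀ N ((l ℕ.+ k) !))))
    (d̃-frac i k m ((1 ℕ.+ N) ℕ.* (2 ℕ.+ N)) Q (ℕ.m≤n⇒m≤1+n i≤m) (cong (P ℕ.*_) (factorial₁ N (N !))))
    (d̃-frac (1 ℕ.+ i) k m (2 ℕ.+ N) Q (s≤s i≤m) (cong (P ℕ.*_) (ℕ.*-comm (2 ℕ.+ N) ((1 ℕ.+ N) !))))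
    (trans (d̃-frac (2 ℕ.+ i) k m 1 Q (s≤s i<m) (cong (P ℕ.*_) (sym (ℕ.*-identityʳ ((2 ℕ.+ N) !)))))
      (cong (λ x → + x / Q) (ℕ.*-identityˡ e)))
    (gap-normalized N a b c e {{numerator≢0 m i i≤m}} (proj₁ gap) (proj₂ gap))
  where
  i = suc l
  a = numerator m l
  b = numerator m i
  c = numerator m (1 ℕ.+ i)
  e = numerator m (2 ℕ.+ i)
  N = i ℕ.+ k
  P = 2 ^ (2 ℕ.* m)
  Q = P ℕ.* (2 ℕ.+ N) !
  instance
    _ : NonZero Q
    _ = ℕ.m*n≢0 P ((2 ℕ.+ N) !) {{ℕ.m^n≢0 2 (2 ℕ.* m)}} {{(2 ℕ.+ N) ℕ.!≢0}}
  i≤m : i ℕ.≤ m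
  i≤m = ℕ.<⇒≤ i<m
  l≤m : l ℕ.≤ m
  l≤m = ℕ.<⇒≤ i≤m
  factorial₀ : ∀ N f → (2 ℕ.+ N) ℕ.* ((1 ℕ.+ N) ℕ.* (N ℕ.* f)) ≡ f ℕ.* (N ℕ.* (1 ℕ.+ N) ℕ.* (2 ℕ.+ N))
  factorial₀ = solve-∀
  factorial₁ : ∀ N f → (2 ℕ.+ N) ℕ.* ((1 ℕ.+ N) ℕ.* f) ≡ f ℕ.* ((1 ℕ.+ N) ℕ.* (2 ℕ.+ N))
  factorial₁ = solve-∀
  gap = numerator-gap m (m ∸ suc i) l (trans (sym (ℕ.+-suc (m ∸ suc i) i)) (ℕ.m∸n+n≡m i<m))

theorem1p2 : (k m i : ℕ) → 2 ℕ.≤ m → 1 ℕ.≤ i → i ℕ.≤ m ∸ 1 →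
    d̃ i k m ² * (d̃ i k m ² - d̃ (i ∸ 1) k m * d̃ (i ℕ.+ 1) k m)
    > d̃ (i ∸ 1) k m ² * (d̃ (i ℕ.+ 1) k m ² - d̃ i k m * d̃ (i ℕ.+ 2) k m)
theorem1p2 k (suc m) (suc l) _ _ i≤m = subst₂
  (λ x y → d̃ l k (suc m) ² * (d̃ (suc x) k (suc m) ² - d̃ (suc l) k (suc m) * d̃ (suc y) k (suc m)) <
    d̃ (suc l) k (suc m) ² * (d̃ (suc l) k (suc m) ² - d̃ l k (suc m) * d̃ (suc x) k (suc m)))
  (ℕ.+-comm 1 l) (ℕ.+-comm 2 l) (d̃-gap k (suc m) l (s≤s i≤m))
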